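{- For $f\in\mathbf{B}_{k,n}$, $P\in\mathcal{P}_{k,n}$ and $A\in\operatorname{Deo}^{\max}_{f,P}$, the Deograph $G(A)$ is a forest. Moreover, its connected components are precisely the supports of the cycles of $\overline f$.
   Context: Let $n\ge 1$, $0\le k\le n$, $[n]=\{1,\dots,n\}$. An $n$-periodic affine permutation is a bijection $f:\mathbb{Z}\to\mathbb{Z}$ with $f(i+n)=f(i)+n$ for all $i$. $\mathbf{B}_{k,n}$ is the set of those with $\frac1n\sum_{i=1}^n(f(i)-i)=k$ and $i\le f(i)\le i+n$ for all $i$. $\overline f\in S_n$ is $f$ reduced modulo $n$, and $c(\overline f)$ is its number of cycles (fixed points included, with support a single element). Lattice paths: $\mathcal{P}_{k,n}$ is the set of lattice paths $P$ from $(0,0)$ to $(n-k,k)$ with unit steps $P_1,\dots,P_n\in\{\mathrm R,\mathrm U\}$ (right, up). Extend $P$ to a bi-infinite path with steps indexed by $\mathbb{Z}$ via $P_{i+n}=P_i$ (step $1$ starts at $(0,0)$); it is invariant under translation by $(n-k,k)$. The strip of $P$ is the region between the extended path $P$ (southern boundary) and its translate $P+(0,k)$ (northern boundary). On each boundary the unit edges are labeled by $\mathbb{Z}$: the southern edge labeled $i$ is step $i$ of $P$, and the northern edge labeled $i$ is its translate by $(0,k)$. Fillings: a periodic filling assigns to each unit box of the strip a crossing or an elbow, invariantly under translation by $(n-k,k)$. Strands enter at the northern boundary edges (a strand is labeled by the index of its northern edge) and travel right/down: in a crossing box a strand entering from the left exits right and one entering from the top exits at the bottom; in an elbow box a strand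 entering from the left exits at the bottom and one entering from the top exits right. The strand permutation sends $i$ to $j$ if the strand entering at northern edge $i$ exits at southern edge $j$. An $(f,P)$-affine Deogram is a periodic filling with strand permutation $f$ such that whenever two strands form an elbow in a box, they have crossed each other an even number of times in boxes traversed before it (counting from the northern boundary). $\operatorname{Deo}^{\max}_{f,P}$ is the set of those having exactly $n-c(\overline f)$ elbows modulo translation by $(n-k,k)$. The Deograph $G(A)$ is the multigraph with vertex set $[n]$ and one edge for each elbow of $A$ modulo translation by $(n-k,k)$, joining the labels modulo $n$ of the two strands forming that elbow. (A multigraph is a forest if it has no cycles; in particular no loops and no parallel edges.) -}

module Defs where

open import Data.Fin.Base using (Fin; toℕ; fromℕ<)
open import Data.Integer.Base as ℤ using (ℤ; +_; -[1+_]; 0ℤ; 1ℤ; _%ℕ_)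
open import Data.Integer.DivMod using (n%ℕd<d)
import Data.Integer.Properties as ℤ
open import Data.List.Base using (List; []; _∷_; length; filter)
open import Data.List.Relation.Unary.AllPairs using (AllPairs)
open import Data.List.Relation.Unary.Unique.Propositional using (Unique)
open import Data.Nat.Base as ℕ using (ℕ; suc; _∸_; NonZero)
open import Data.Nat.Divisibility using (_∣_)
open import Data.Nat.GeneralisedArithmetic using (iterate)
open import Data.Product.Base using (Σ-syntax; ∃-syntax; _×_; _,_; proj₁)
open import Data.Product.Properties using (≡-dec)
import Data.Rational.Base as ℚ
open import Data.Sum.Base using (_⊎_)
open import Data.Vec.Base using (Vec; lookup; count)
import Data.Vec.Functional as Vector
open import Function.Definitions using (Bijective)
open import Level using (0ℓ)
open import Relation.Binary.Construct.Closure.ReflexiveTransitive using (Star)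
open import Relation.Binary.Core using (Rel)
open import Relation.Binary.Definitions using (DecidableEquality)
open import Relation.Binary.PropositionalEquality.Core using (_≡_; refl)
open import Relation.Nullary.Decidable.Core using (yes; no; _×-dec_)
open import Relation.Nullary.Negation.Core using (¬_)
open import Relation.Unary using (Pred; _≐_)

-- For an equivalence relation: there are exactly m classes, witnessed by a
-- complete system of m pairwise inequivalent representatives.
HasClasses : {A : Set} → Rel A 0ℓ → ℕ → Set
HasClasses {A} _~_ m =
  Σ[ rep ∈ (Fin m → A) ]
    (∀ p q → rep p ~ rep q → p ≡ q) × (∀ a → ∃[ p ] rep p ~ a)

------------------------------------------------------------------------
-- Multigraphs

-- The edges of the multigraph are the elements of Edge up to _≈_ ;
-- Joins e u v says that the (unordered) endpoints of e are u and v.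
record Multigraph (V : Set) : Set₁ where
  field
    Edge  : Set
    _≈_   : Rel Edge 0ℓ
    Joins : Edge → V → V → Set

module _ {V : Set} (G : Multigraph V) where
  open Multigraph G

  -- Walk u es vs w : a walk from u to w along the edges es, where vs lists the
  -- vertices visited, without the last one (so that the vertices of a closed
  -- walk are listed once each).
  data Walk : V → List Edge → List V → V → Set where
    []  : ∀ {u} → Walk u [] [] u
    _∷_ : ∀ {e es u v vs w} →
          Joins e u v → Walk v es vs w → Walk u (e ∷ es) (u ∷ vs) w

  -- Length 1 is a loop, length 2 a pair of parallel edges.
  record Cycle : Set where
    field
      base             : V
      first            : Edge
      rest             : List Edge
      vertices         : List V
      walk             : Walk base (first ∷ rest) vertices base
      distinctVertices : Unique vertices
      distinctEdges    : AllPairs (λ e e′ → ¬ (e ≈ e′)) (first ∷ rest)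

  Forest : Set
  Forest = ¬ Cycle

  Connected : Rel V 0ℓ
  Connected = Star (λ u v → ∃[ e ] Joins e u v)

  IsComponent : Pred V 0ℓ → Set
  IsComponent S = ∃[ v ] S ≐ Connected v

------------------------------------------------------------------------
-- Permutations of [n]

-- v lies on the cycle of σ through u.
SameCycle : ∀ {n} → (Fin n → Fin n) → Rel (Fin n) 0ℓ
SameCycle σ u v = ∃[ m ] iterate σ u m ≡ v

IsCycleSupport : ∀ {n} → (Fin n → Fin n) → Pred (Fin n) 0ℓ → Set
IsCycleSupport σ S = ∃[ v ] S ≐ SameCycle σ v

------------------------------------------------------------------------
-- Affine permutations

-- The element j of Fin n stands for toℕ j + 1 in [n] = {1,…,n}.
label : ∀ {n} → Fin n → ℤ
label j = + suc (toℕ j)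

residue : ∀ {n} .{{_ : NonZero n}} → ℤ → Fin n
residue {n} i = fromℕ< (n%ℕd<d (i ℤ.- 1ℤ) n)

record BoundedAffinePermutation (k n : ℕ) .{{_ : NonZero n}} : Set where
  field
    fun       : ℤ → ℤ
    bijective : Bijective _≡_ _≡_ fun
    periodic  : ∀ i → fun (i ℤ.+ + n) ≡ fun i ℤ.+ + n
    average   : Vector.foldr ℤ._+_ 0ℤ (λ (j : Fin n) → fun (label j) ℤ.- label j) ℚ./ n
                ≡ + k ℚ./ 1
    lower     : ∀ i → i ℤ.≤ fun i
    upper     : ∀ i → fun i ℤ.≤ i ℤ.+ + n

  reduced : Fin n → Fin n
  reduced j = residue (fun (label j))

------------------------------------------------------------------------
-- The plane

Point : Set
Point = ℤ × ℤ

infixl 6 _+ₚ_ _-ₚ_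
infixl 7 _·ₚ_

_+ₚ_ : Point → Point → Point
(x , y) +ₚ (x′ , y′) = (x ℤ.+ x′) , (y ℤ.+ y′)

_-ₚ_ : Point → Point → Point
(x , y) -ₚ (x′ , y′) = (x ℤ.- x′) , (y ℤ.- y′)

_·ₚ_ : ℤ → Point → Point
t ·ₚ (x , y) = (t ℤ.* x) , (t ℤ.* y)

data Step : Set where
  R U : Step

_≟ˢ_ : DecidableEquality Step
R ≟ˢ R = yes refl
R ≟ˢ U = no λ ()
U ≟ˢ R = no λ ()
U ≟ˢ U = yes refl

vector : Step → Point
vector R = 1ℤ , 0ℤ
vector U = 0ℤ , 1ℤ

-- (s , p) is the unit edge from p to p +ₚ vector s.
UnitEdge : Set
UnitEdge = Step × Point

-- A unit box is given by its lower left corner.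
Box : Set
Box = Point

_≟ᴮ_ : DecidableEquality Box
_≟ᴮ_ = ≡-dec ℤ._≟_ ℤ._≟_

open import Data.List.Membership.DecPropositional _≟ᴮ_ using (_∈?_)

left right top bottom : Box → UnitEdge
left   B = U , B
right  B = U , B +ₚ vector R
top    B = R , B +ₚ vector U
bottom B = R , B

-- The box entered by a strand moving right/down through a given edge:
-- through a vertical edge it enters from the left, through a horizontal edge
-- from the top.
entered : UnitEdge → Box
entered (U , p) = p
entered (R , p) = p -ₚ vector U

data Tile : Set where
  crossing elbow : Tile

_≟ᵀ_ : DecidableEquality Tile
crossing ≟ᵀ crossing = yes refl
crossing ≟ᵀ elbow    = no λ ()
elbow    ≟ᵀ crossing = no λ ()
elbow    ≟ᵀ elbow    = yes refl

-- The edge through which a strand leaves the box B, given the direction of the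
-- edge through which it entered (U: from the left, R: from the top).
exit : Tile → Step → Box → UnitEdge
exit crossing U B = right B
exit crossing R B = bottom B
exit elbow    U B = bottom B
exit elbow    R B = right B

------------------------------------------------------------------------
-- Lattice paths

-- A path with n steps, k of them up, hence from (0,0) to (n-k,k).
record LatticePath (k n : ℕ) : Set where
  field
    steps : Vec Step n
    ups   : count (U ≟ˢ_) steps ≡ k

module _ {k n : ℕ} .{{_ : NonZero n}} (P : LatticePath k n) where
  open LatticePath P

  step : ℤ → Step
  step i = lookup steps (residue i)

  -- The endpoint of step i, i.e. the starting point of step i + 1.
  point : ℤ → Point
  point (+ 0)        = 0ℤ , 0ℤ
  point (+ suc m)    = point (+ m) +ₚ vector (step (+ suc m))
  point -[1+ 0 ]     = point (+ 0) -ₚ vector (step (+ 0))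
  point -[1+ suc m ] = point -[1+ m ] -ₚ vector (step -[1+ m ])

  southern : ℤ → UnitEdge
  southern i = step i , point (i ℤ.- 1ℤ)

  northern : ℤ → UnitEdge
  northern i = step i , point (i ℤ.- 1ℤ) +ₚ (0ℤ , + k)

  period : Point
  period = + (n ∸ k) , + k

  -- The box in column a and row b lies above the southern and below the
  -- northern boundary edge of its column.
  InStrip : Box → Set
  InStrip (a , b) =
      (∃[ i ] ∃[ h ] southern i ≡ (R , (a , h)) × h ℤ.≤ b)
    × (∃[ i ] ∃[ h ] northern i ≡ (R , (a , h)) × b ℤ.+ 1ℤ ℤ.≤ h)

  -- The value of tile outside the strip is junk and is never used.
  record Filling : Set where
    field
      tile     : Box → Tile
      periodic : ∀ B → InStrip B → tile (B +ₚ period) ≡ tile B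

  module _ (A : Filling) where
    open Filling A

    -- Strand i Bs e : the strand entering at northern edge i passes through the
    -- edge e, having traversed exactly the boxes Bs before (last one first).
    data Strand (i : ℤ) : List Box → UnitEdge → Set where
      enter : Strand i [] (northern i)
      pass  : ∀ {Bs e} → Strand i Bs e → InStrip (entered e) →
              Strand i (entered e ∷ Bs) (exit (tile (entered e)) (proj₁ e) (entered e))

    HasStrandPermutation : (ℤ → ℤ) → Set
    HasStrandPermutation f = ∀ i → ∃[ Bs ] Strand i Bs (southern (f i))

    -- Number of crossings of two strands, given the boxes each has traversed.
    crossings : List Box → List Box → ℕ
    crossings Bs Cs = length (filter (λ B → (B ∈? Cs) ×-dec (tile B ≟ᵀ crossing)) Bs)

    record Elbow : Set where
      field
        box     : Box
        inStrip : InStrip box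
        isElbow : tile box ≡ elbow
    open Elbow

    _≈ᴱ_ : Rel Elbow 0ℓ
    E ≈ᴱ E′ = ∃[ t ] box E′ ≡ box E +ₚ t ·ₚ period

    record IsDeogram (f : ℤ → ℤ) : Set where
      field
        strandPermutation : HasStrandPermutation f
        distinguished     : ∀ (E : Elbow) {i j Bs Cs} →
                            Strand i Bs (left (box E)) → Strand j Cs (top (box E)) →
                            2 ∣ crossings Bs Cs

    deograph : Multigraph (Fin n)
    deograph = record
      { Edge  = Elbow
      ; _≈_   = _≈ᴱ_
      ; Joins = λ E u v → ∃[ i ] ∃[ j ] ∃[ Bs ] ∃[ Cs ]
                  Strand i Bs (left (box E)) × Strand j Cs (top (box E)) ×
                  ((u ≡ residue i × v ≡ residue j) ⊎ (u ≡ residue j × v ≡ residue i))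
      }

-- Membership in Deo^max; the c below is the number of cycles of the reduction
-- of f modulo n.
record IsMaximalDeogram {k n : ℕ} .{{_ : NonZero n}} (f : BoundedAffinePermutation k n)
                        (P : LatticePath k n) (A : Filling P) : Set where
  open BoundedAffinePermutation f using (fun; reduced)
  field
    isDeogram  : IsDeogram P A fun
    elbowCount : ∃[ c ] HasClasses (SameCycle reduced) c × HasClasses (_≈ᴱ_ P A) (n ∸ c)

{-# OPTIONS --safe #-}
module Submission where

-- If all boxes were crossings, every strand would keep to its row or column and
-- the strand permutation would be trivial modulo n. By induction along the
-- strip, the strand through an edge is connected in the Deograph to the strand
-- that would pass there in the all-crossing filling: at an elbow the two strands
-- swap lines, but they are adjacent. Hence i and f i are connected, and each
-- cycle of the reduction lies in one component. A graph with n vertices and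
-- n - c edges has at least c components, with equality only for a forest; as
-- there are c cycles, equality holds and the components are the cycles.

open import Defs
open import Algebra.Properties.AbelianGroup using (∙-cancelˡ; ∙-cancelʳ)
open import Data.Bool.Base using (if_then_else_)
open import Data.Fin.Base as Fin using (Fin; toℕ; punchIn; punchOut)
import Data.Fin.Properties as Fin
open import Data.Integer.Base as ℤ using (ℤ; +_; -[1+_]; 0ℤ; 1ℤ; -1ℤ; _+_; _*_; _-_; _/ℕ_; _%ℕ_; ∣_∣)
open import Data.Integer.DivMod using (a≡a%ℕn+[a/ℕn]*n; n%ℕd<d)
import Data.Integer.Properties as ℤ
open import Data.Integer.Tactic.RingSolver using (solve-∀)
open import Data.List.Base using ([]; _∷_)
open import Data.List.Relation.Unary.All as All using (All; []; _∷_)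
open import Data.List.Relation.Unary.AllPairs using (_∷_)
open import Data.Nat.Base as ℕ using (ℕ; zero; suc; _≤_; _∸_; NonZero)
import Data.Nat.DivMod as ℕ
open import Data.Nat.GeneralisedArithmetic using (iterate)
import Data.Nat.Properties as ℕ
open import Data.Product.Base using (Σ-syntax; ∃-syntax; _×_; _,_; proj₁; proj₂)
open import Data.Sum.Base using (_⊎_; inj₁; inj₂)
open import Data.Vec.Base using (Vec; []; _∷_; lookup; count)
open import Function.Base using (_∘_; case_of_)
open import Function.Bundles using (_⇔_; mk⇔)
open import Level using (0ℓ)
open import Relation.Binary.Construct.Closure.ReflexiveTransitive as Star using (ε; _◅_; _◅◅_)
open import Relation.Binary.Definitions using (tri<; tri≈; tri>)
open import Relation.Binary.PropositionalEquality
open import Relation.Nullary.Decidable.Core using (does; yes; no)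
open import Relation.Nullary.Negation.Core using (¬_; contradiction)
open import Relation.Unary using (Pred)

-- Counting components

-- Two strands meeting at an elbow give an edge of the Deograph only if both exist, and in an
-- infinite strip it is not evident that tracing backwards from a box ends at the northern boundary.
-- So existence of a strand through an edge and its link to the label of that edge are proved in a
-- single backward induction, moving up and left. It ends because the northern boundary drops below
-- any given row far to the left, which bounds the columns, and never gets higher on the way left,
-- which bounds the rows.
--
-- The count is used through its lack of slack: if `m` edges and `r` chosen vertices reach every
-- vertex, then `n ≤ m + r`. With `m = n - c` and `r = c` nothing can be spared. A connection
-- between two cycle representatives would make one of them redundant, and a cycle of the graph
-- would make one edge redundant.
--
-- Edges are elbows modulo translation, so endpoints must be well defined on classes: translation by
-- a period shifts strand indices by `n`, and each edge of the strip lies on at most one strand.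

remove : ∀ {A : Set} {m} (p : Fin m) (f : Fin m → A) →
         ∃[ m′ ] Σ[ g ∈ (Fin m′ → A) ]
           suc m′ ≡ m × (∀ q → p ≢ q → ∃[ r ] g r ≡ f q)
remove {m = suc m} p f = m , f ∘ punchIn p , refl ,
  λ q p≢q → punchOut p≢q , cong f (Fin.punchIn-punchOut p≢q)

collapse : ∀ {n} → Fin n → Fin n → Fin n → Fin n
collapse a b v = if does (v Fin.≟ b) then a else v

collapse-≡ : ∀ {n} (a b : Fin n) → collapse a b a ≡ collapse a b b
collapse-≡ a b with a Fin.≟ b | b Fin.≟ b
... | _     | no b≢b = contradiction refl b≢b
... | yes _ | yes _  = refl
... | no _  | yes _  = refl

-- A union-find: each edge in turn redirects the current label of its second end to that of its
-- first. The labels then agree along every edge, and counting them bounds the number of components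
-- without constructing any.
merge : ∀ {m n} → (Fin m → Fin n × Fin n) → Fin n → Fin n
merge {zero}  ends v = v
merge {suc m} ends v =
  collapse (g (proj₁ (ends Fin.zero))) (g (proj₂ (ends Fin.zero))) (g v)
  where g = merge (ends ∘ Fin.suc)

merge-ends : ∀ {m n} (ends : Fin m → Fin n × Fin n) p →
             merge ends (proj₁ (ends p)) ≡ merge ends (proj₂ (ends p))
merge-ends {suc m} ends Fin.zero = collapse-≡ (merge (ends ∘ Fin.suc) (proj₁ (ends Fin.zero))) _
merge-ends {suc m} ends (Fin.suc p) = cong (collapse _ _) (merge-ends (ends ∘ Fin.suc) p)

surjective⇒≤ : ∀ {r n} (L : Fin r → Fin n) → (∀ v → ∃[ p ] L p ≡ v) → n ≤ r
surjective⇒≤ L sur = Fin.injective⇒≤ {f = proj₁ ∘ sur}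
  λ {u} {v} eq → trans (sym (proj₂ (sur u))) (trans (cong L eq) (proj₂ (sur v)))

-- Each edge lowers the number of values of merge by at most one.
merge-values : ∀ {m n r} (ends : Fin m → Fin n × Fin n) (L : Fin r → Fin n) →
               (∀ v → ∃[ p ] L p ≡ merge ends v) → n ≤ m ℕ.+ r
merge-values {zero}         ends L cover = surjective⇒≤ L cover
merge-values {suc m} {n} {r} ends L cover =
  subst (n ≤_) (ℕ.+-suc m r) (merge-values (ends ∘ Fin.suc) L′ cover′)
  where
  g = merge (ends ∘ Fin.suc)
  a = g (proj₁ (ends Fin.zero))
  b = g (proj₂ (ends Fin.zero))
  L′ : Fin (suc r) → Fin n
  L′ Fin.zero    = b
  L′ (Fin.suc p) = L p
  uncollapse : ∀ v → v ≢ b → collapse a b v ≡ v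
  uncollapse v v≢b with v Fin.≟ b
  ... | yes v≡b = contradiction v≡b v≢b
  ... | no _    = refl
  cover′ : ∀ v → ∃[ p ] L′ p ≡ g v
  cover′ v with g v Fin.≟ b
  ... | yes gv≡b = Fin.zero , sym gv≡b
  ... | no gv≢b  = let (p , eq) = cover v in Fin.suc p , trans eq (uncollapse (g v) gv≢b)

-- Multigraphs with few edges

module _ {V : Set} (G : Multigraph V) where
  open Multigraph G

  connected-invariant : ∀ {A : Set} (g : V → A) →
    (∀ {e u v} → Joins e u v → g u ≡ g v) → ∀ {u v} → Connected G u v → g u ≡ g v
  connected-invariant g inv ε              = refl
  connected-invariant g inv ((_ , j) ◅ js) = trans (inv j) (connected-invariant g inv js)

  -- Only the edges of this particular walk have to preserve `g`, as is the case for a cycle with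
  -- its first edge taken away.
  walk-invariant : ∀ {A : Set} (g : V → A) {u es vs w} → Walk G u es vs w →
    All (λ e → ∀ {x y} → Joins e x y → g x ≡ g y) es → g u ≡ g w
  walk-invariant g []       []         = refl
  walk-invariant g (j ∷ js) (inv ∷ is) = trans (inv j) (walk-invariant g js is)

-- Edges are counted up to `_≈_`, so `class` numbers the classes and `ends` orders the two endpoints
-- of each arbitrarily. This turns the graph into the finite list of pairs that `merge` takes.
module FewEdges {n m c : ℕ} (G : Multigraph (Fin n))
  (class : Multigraph.Edge G → Fin m)
  (class-≈ : ∀ {e e′} → class e ≡ class e′ → Multigraph._≈_ G e e′)
  (ends : Fin m → Fin n × Fin n)
  (joins-ends : ∀ {e u v} → Multigraph.Joins G e u v →
                ends (class e) ≡ (u , v) ⊎ ends (class e) ≡ (v , u))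
  (roots : Fin c → Fin n) (reach : ∀ v → ∃[ p ] Connected G (roots p) v)
  (m+c≡n : m ℕ.+ c ≡ n)
  where
  open Multigraph G

  respects : ∀ {A : Set} (g : Fin n → A) {e u v} → Joins e u v →
    g (proj₁ (ends (class e))) ≡ g (proj₂ (ends (class e))) → g u ≡ g v
  respects g {e} j eq with ends (class e) | joins-ends j
  ... | _ | inj₁ refl = eq
  ... | _ | inj₂ refl = sym eq

  -- If distinct roots `p` and `q` were connected, `q` could stand in for `p`. The other `c - 1`
  -- roots would then still meet all values of `merge ends`, giving `n ≤ m + (c - 1)`.
  roots-unconnected : ∀ {p q} → Connected G (roots p) (roots q) → p ≡ q
  roots-unconnected {p} {q} pq with p Fin.≟ q
  ... | yes p≡q = p≡q
  ... | no p≢q with remove p roots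
  ... | c′ , roots′ , sc′≡c , others =
    contradiction
      (subst (_≤ m ℕ.+ c′) (trans (sym m+c≡n) (trans (cong (m ℕ.+_) (sym sc′≡c)) (ℕ.+-suc m c′)))
        (merge-values ends (g ∘ roots′) cover))
      ℕ.1+n≰n
    where
    g = merge ends
    g-connected : ∀ {u v} → Connected G u v → g u ≡ g v
    g-connected = connected-invariant G g (λ j → respects g j (merge-ends ends _))
    cover : ∀ v → ∃[ r ] g (roots′ r) ≡ g v
    cover v with reach v
    ... | s , sv with p Fin.≟ s
    ... | yes refl = let (r , eq) = others q p≢q in
                     r , trans (cong g eq) (trans (sym (g-connected pq)) (g-connected sv))
    ... | no p≢s   = let (r , eq) = others s p≢s in r , trans (cong g eq) (g-connected sv)

  -- Discard the class of the first edge of a cycle. The remaining edges of the cycle lie in other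
  -- classes and still join its two ends, so the merged labels stay constant along all edges. The
  -- roots then meet every label with only `m - 1` pairs, giving `n ≤ (m - 1) + c`.
  forest : Forest G
  forest record { first = e₀ ; rest = es ; walk = j₀ ∷ js ; distinctEdges = ≉s ∷ _ }
    with remove (class e₀) ends
  ... | m′ , ends′ , sm′≡m , others =
    contradiction
      (subst (_≤ m′ ℕ.+ c) (trans (sym m+c≡n) (cong (ℕ._+ c) (sym sm′≡m)))
        (merge-values ends′ (g ∘ roots) cover))
      ℕ.1+n≰n
    where
    g = merge ends′
    g-other : ∀ {e u v} → class e₀ ≢ class e → Joins e u v → g u ≡ g v
    g-other {e} ≢e j = let (r , eq) = others (class e) ≢e in
      respects g j (subst (λ (x , y) → g x ≡ g y) eq (merge-ends ends′ r))
    -- The rest of the cycle connects the two ends of e₀.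
    g-first : ∀ {u v} → Joins e₀ u v → g u ≡ g v
    g-first {u} {v} j with joins-ends j | joins-ends j₀
                    | walk-invariant G g js (All.map (λ ≉e {x} {y} → g-other (≉e ∘ class-≈)) ≉s)
    ... | inj₁ p | inj₁ q | eq with refl ← trans (sym p) q = sym eq
    ... | inj₁ p | inj₂ q | eq with refl ← trans (sym p) q = eq
    ... | inj₂ p | inj₁ q | eq with refl ← trans (sym p) q = eq
    ... | inj₂ p | inj₂ q | eq with refl ← trans (sym p) q = sym eq
    g-all : ∀ {e u v} → Joins e u v → g u ≡ g v
    g-all {e} j with class e₀ Fin.≟ class e
    ... | no ≢e = g-other ≢e j
    -- Edges of the class of `e₀` share its pair of ends, so the case of `e₀` itself suffices.
    ... | yes ≡e = respects g j (subst (λ p → g (proj₁ (ends p)) ≡ g (proj₂ (ends p))) ≡e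
                     (case joins-ends j₀ of λ where
                        (inj₁ p) → subst (λ (x , y) → g x ≡ g y) (sym p) (g-first j₀)
                        (inj₂ p) → subst (λ (x , y) → g x ≡ g y) (sym p) (sym (g-first j₀))))
    cover : ∀ v → ∃[ r ] g (roots r) ≡ g v
    cover v = let (r , rv) = reach v in r , connected-invariant G g g-all rv

-- Cycles of an injection of Fin n

module _ {n} {σ : Fin n → Fin n} (σ-injective : ∀ {u v} → σ u ≡ σ v → u ≡ v) where

  iterate-+ : ∀ l m {u} → iterate σ u (l ℕ.+ m) ≡ iterate σ (iterate σ u l) m
  iterate-+ zero    m = refl
  iterate-+ (suc l) m = iterate-+ l m

  iterate-injective : ∀ m {u v} → iterate σ u m ≡ iterate σ v m → u ≡ v
  iterate-injective zero    eq = eq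
  iterate-injective (suc m) eq = σ-injective (iterate-injective m eq)

  sameCycle-trans : ∀ {u v w} → SameCycle σ u v → SameCycle σ v w → SameCycle σ u w
  sameCycle-trans (l , refl) (m , refl) = l ℕ.+ m , iterate-+ l m

  -- `SameCycle` iterates only forwards, so going back requires a period. Among the `n + 1` iterates
  -- of `u` with exponents `0` to `n` two coincide; cancelling the smaller exponent by injectivity
  -- returns to `u`.
  sameCycle-back : ∀ u → SameCycle σ (σ u) u
  sameCycle-back u with Fin.pigeonhole (ℕ.n<1+n n) (iterate σ u ∘ toℕ)
  ... | i , j , i<j , eq with ℕ.m≤n⇒∃[o]m+o≡n i<j
  ... | d , si+d≡j = d , iterate-injective (toℕ i) (begin
    iterate σ (iterate σ (σ u) d) (toℕ i) ≡⟨ iterate-+ (suc d) (toℕ i) ⟨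
    iterate σ u (suc d ℕ.+ toℕ i)         ≡⟨ cong (iterate σ u ∘ suc) (ℕ.+-comm d (toℕ i)) ⟩
    iterate σ u (suc (toℕ i) ℕ.+ d)       ≡⟨ cong (iterate σ u) si+d≡j ⟩
    iterate σ u (toℕ j)                   ≡⟨ eq ⟨
    iterate σ u (toℕ i)                   ∎)
    where open ≡-Reasoning

  sameCycle-sym : ∀ {u v} → SameCycle σ u v → SameCycle σ v u
  sameCycle-sym         (zero  , refl) = zero , refl
  sameCycle-sym {u} (suc m , eq)   =
    sameCycle-trans (sameCycle-sym (m , eq)) (sameCycle-back u)

-- Integers

ℤ-induction : (Q : ℤ → Set) → Q 0ℤ → (∀ i → Q i → Q (1ℤ + i)) → (∀ i → Q (1ℤ + i) → Q i) →
              ∀ i → Q i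
ℤ-induction Q base up down (+ zero)       = base
ℤ-induction Q base up down (+ suc m)      = up (+ m) (ℤ-induction Q base up down (+ m))
ℤ-induction Q base up down -[1+ zero ]    = down -[1+ 0 ] base
ℤ-induction Q base up down -[1+ suc m ]   = down -[1+ suc m ] (ℤ-induction Q base up down -[1+ m ])

+-cancelʳ : ∀ i j k → j + i ≡ k + i → j ≡ k
+-cancelʳ = ∙-cancelʳ ℤ.+-0-abelianGroup

+-cancelˡ : ∀ i j k → i + j ≡ i + k → j ≡ k
+-cancelˡ = ∙-cancelˡ ℤ.+-0-abelianGroup

1+i≰i : ∀ {i} → ¬ (1ℤ + i ℤ.≤ i)
1+i≰i {i} le = ℤ.<-irrefl refl (ℤ.suc[i]≤j⇒i<j {i} le)

-∣i∣≤i : ∀ i → ℤ.- (+ ∣ i ∣) ℤ.≤ i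
-∣i∣≤i (+ m)    = ℤ.neg-≤-pos
-∣i∣≤i -[1+ m ] = ℤ.≤-refl

i≤∣i∣ : ∀ i → i ℤ.≤ + ∣ i ∣
i≤∣i∣ (+ m)    = ℤ.≤-refl
i≤∣i∣ -[1+ m ] = ℤ.-≤+

1+[i-1]≡i : ∀ i → 1ℤ + (i - 1ℤ) ≡ i
1+[i-1]≡i = solve-∀

i+0*j≡i : ∀ i j → i + 0ℤ * j ≡ i
i+0*j≡i = solve-∀

i+t*j+j≡i+[1+t]*j : ∀ i t j → i + t * j + j ≡ i + (1ℤ + t) * j
i+t*j+j≡i+[1+t]*j = solve-∀

-- Rearranging an inequality becomes a ring identity between differences, which the solver can
-- prove.
≤-shift : ∀ {p q a b} → q - p ≡ b - a → p ℤ.≤ q → a ℤ.≤ b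
≤-shift eq p≤q = ℤ.0≤i-j⇒j≤i (subst (0ℤ ℤ.≤_) eq (ℤ.i≤j⇒0≤j-i p≤q))

quotient-<⇒remainder-≥ : ∀ {n r r′ q q′} → + r + q * + n ≡ + r′ + q′ * + n → q ℤ.< q′ → n ≤ r
quotient-<⇒remainder-≥ {n} {r} {r′} {q} {q′} eq q<q′ = ℤ.drop‿+≤+ (begin
  + n                              ≤⟨ ≤-shift (identity (+ n) (+ r′) q q′)
                                        (ℤ.+-mono-≤ (ℤ.+≤+ (ℕ.z≤n {r′}))
                                          (ℤ.*-monoʳ-≤-nonNeg (+ n) (ℤ.i<j⇒suc[i]≤j q<q′))) ⟩
  + r′ + q′ * + n - q * + n        ≡⟨ cong (_- q * + n) eq ⟨
  + r + q * + n - q * + n          ≡⟨ cancel (+ r) (q * + n) ⟩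
  + r                              ∎)
  where
  open ℤ.≤-Reasoning
  identity : ∀ n r q q′ → (r + q′ * n) - (0ℤ + (1ℤ + q) * n) ≡ (r + q′ * n - q * n) - n
  identity = solve-∀
  cancel : ∀ x y → x + y - y ≡ x
  cancel = solve-∀

remainder-unique : ∀ {n r r′} q q′ → r ℕ.< n → r′ ℕ.< n →
                   + r + q * + n ≡ + r′ + q′ * + n → r ≡ r′
remainder-unique {n} q q′ r<n r′<n eq with ℤ.<-cmp q q′
... | tri< q<q′ _ _ = contradiction (quotient-<⇒remainder-≥ {n} eq q<q′) (ℕ.<⇒≱ r<n)
... | tri> _ _ q′<q = contradiction (quotient-<⇒remainder-≥ {n} (sym eq) q′<q) (ℕ.<⇒≱ r′<n)
... | tri≈ _ refl _ = ℤ.+-injective (+-cancelʳ (q * + n) _ _ eq)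

-- Residues modulo `n`

module _ {n : ℕ} .{{_ : NonZero n}} where

  residue-shift : ∀ t i → residue {n} (i + t * + n) ≡ residue i
  residue-shift t i = Fin.fromℕ<-cong _ _
    (remainder-unique (j /ℕ n) ((i - 1ℤ) /ℕ n + t) (n%ℕd<d j n) (n%ℕd<d (i - 1ℤ) n) (begin
      + (j %ℕ n) + (j /ℕ n) * + n
        ≡⟨ a≡a%ℕn+[a/ℕn]*n j n ⟨
      i + t * + n - 1ℤ
        ≡⟨ swap i (t * + n) ⟩
      (i - 1ℤ) + t * + n
        ≡⟨ cong (_+ t * + n) (a≡a%ℕn+[a/ℕn]*n (i - 1ℤ) n) ⟩
      + ((i - 1ℤ) %ℕ n) + ((i - 1ℤ) /ℕ n) * + n + t * + n
        ≡⟨ collect (+ ((i - 1ℤ) %ℕ n)) ((i - 1ℤ) /ℕ n) t (+ n) ⟩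
      + ((i - 1ℤ) %ℕ n) + ((i - 1ℤ) /ℕ n + t) * + n
        ∎)) _ _
    where
    open ≡-Reasoning
    j = i + t * + n - 1ℤ
    swap : ∀ i x → i + x - 1ℤ ≡ (i - 1ℤ) + x
    swap = solve-∀
    collect : ∀ r q t n → r + q * n + t * n ≡ r + (q + t) * n
    collect = solve-∀

  residue-≡⇒shift : ∀ i j → residue {n} i ≡ residue j → ∃[ t ] i ≡ j + t * + n
  residue-≡⇒shift i j eq = qᵢ - qⱼ , (begin
    i                                     ≡⟨ unshift i ⟨
    i - 1ℤ + 1ℤ                           ≡⟨ cong (_+ 1ℤ) (a≡a%ℕn+[a/ℕn]*n (i - 1ℤ) n) ⟩
    + rᵢ + qᵢ * + n + 1ℤ                  ≡⟨ cong (λ r → + r + qᵢ * + n + 1ℤ) (Fin.fromℕ<-injective _ _ _ _ eq) ⟩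
    + rⱼ + qᵢ * + n + 1ℤ                  ≡⟨ collect (+ rⱼ) qᵢ qⱼ (+ n) ⟩
    + rⱼ + qⱼ * + n + 1ℤ + (qᵢ - qⱼ) * + n ≡⟨ cong (λ x → x + 1ℤ + (qᵢ - qⱼ) * + n) (a≡a%ℕn+[a/ℕn]*n (j - 1ℤ) n) ⟨
    j - 1ℤ + 1ℤ + (qᵢ - qⱼ) * + n         ≡⟨ cong (_+ (qᵢ - qⱼ) * + n) (unshift j) ⟩
    j + (qᵢ - qⱼ) * + n                   ∎)
    where
    open ≡-Reasoning
    qᵢ = (i - 1ℤ) /ℕ n
    qⱼ = (j - 1ℤ) /ℕ n
    rᵢ = (i - 1ℤ) %ℕ n
    rⱼ = (j - 1ℤ) %ℕ n
    unshift : ∀ i → i - 1ℤ + 1ℤ ≡ i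
    unshift = solve-∀
    collect : ∀ r p q n → r + p * n + 1ℤ ≡ r + q * n + 1ℤ + (p - q) * n
    collect = solve-∀

  residue-label : ∀ (j : Fin n) → residue (label j) ≡ j
  residue-label j = trans (Fin.fromℕ<-cong _ _ (ℕ.m<n⇒m%n≡m (Fin.toℕ<n j)) _ _) (Fin.fromℕ<-toℕ j (Fin.toℕ<n j))

module _ {k n : ℕ} .{{_ : NonZero n}} (f : BoundedAffinePermutation k n) where
  open BoundedAffinePermutation f

  fun-shift : ∀ t i → fun (i + t * + n) ≡ fun i + t * + n
  fun-shift t i = ℤ-induction (λ t → fun (i + t * + n) ≡ fun i + t * + n)
    (trans (cong fun (i+0*j≡i i (+ n))) (sym (i+0*j≡i (fun i) (+ n)))) up down t
    where
    next : ∀ t → fun (i + (1ℤ + t) * + n) ≡ fun (i + t * + n) + + n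
    next t = trans (cong fun (sym (i+t*j+j≡i+[1+t]*j i t (+ n)))) (periodic (i + t * + n))
    up : ∀ t → fun (i + t * + n) ≡ fun i + t * + n → fun (i + (1ℤ + t) * + n) ≡ fun i + (1ℤ + t) * + n
    up t ih = trans (next t) (trans (cong (_+ + n) ih) (i+t*j+j≡i+[1+t]*j (fun i) t (+ n)))
    down : ∀ t → fun (i + (1ℤ + t) * + n) ≡ fun i + (1ℤ + t) * + n → fun (i + t * + n) ≡ fun i + t * + n
    down t ih = +-cancelʳ (+ n) _ _ (trans (sym (next t)) (trans ih (sym (i+t*j+j≡i+[1+t]*j (fun i) t (+ n)))))

  -- Values with equal residues differ by a multiple of `n`, which periodicity moves into the
  -- argument of `fun`, where injectivity applies.
  reduced-injective : ∀ {u v} → reduced u ≡ reduced v → u ≡ v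
  reduced-injective {u} {v} eq = let (t , fu≡fv+tn) = residue-≡⇒shift (fun (label u)) (fun (label v)) eq in begin
    u                              ≡⟨ residue-label u ⟨
    residue (label u)              ≡⟨ cong residue (proj₁ bijective (trans fu≡fv+tn (sym (fun-shift t (label v))))) ⟩
    residue (label v + t * + n)    ≡⟨ residue-shift t (label v) ⟩
    residue (label v)              ≡⟨ residue-label v ⟩
    v                              ∎
    where open ≡-Reasoning

-- Lattice paths

-ₚ-+ₚ : ∀ p v → p -ₚ v +ₚ v ≡ p
-ₚ-+ₚ (a , b) (x , y) = cong₂ _,_ (lemma a x) (lemma b y)
  where
  lemma : ∀ a x → a - x + x ≡ a
  lemma = solve-∀

+ₚ--ₚ : ∀ p v → p +ₚ v -ₚ v ≡ p
+ₚ--ₚ (a , b) (x , y) = cong₂ _,_ (lemma a x) (lemma b y)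
  where
  lemma : ∀ a x → a + x - x ≡ a
  lemma = solve-∀

+ₚ-swap : ∀ p q r → p +ₚ q +ₚ r ≡ p +ₚ r +ₚ q
+ₚ-swap (x , y) (x′ , y′) (x″ , y″) = cong₂ _,_ (lemma x x′ x″) (lemma y y′ y″)
  where
  lemma : ∀ x y z → x + y + z ≡ x + z + y
  lemma = solve-∀

-- Heights `y` and steps `s` are arbitrary sequences so that the induction can drop the first step
-- and reindex both.
height-count : ∀ {l} (xs : Vec Step l) (y : ℕ → ℤ) (s : ℕ → Step) →
  (∀ m → y (suc m) ≡ y m + proj₂ (vector (s m))) → (∀ j → s (toℕ j) ≡ lookup xs j) →
  y l ≡ y 0 + + count (U ≟ˢ_) xs
height-count []       y s rec agree = sym (ℤ.+-identityʳ (y 0))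
height-count (x ∷ xs) y s rec agree = begin
  _
    ≡⟨ height-count xs (y ∘ suc) (s ∘ suc) (rec ∘ suc) (agree ∘ Fin.suc) ⟩
  y 1 + + count (U ≟ˢ_) xs
    ≡⟨ cong (_+ + count (U ≟ˢ_) xs) (rec 0) ⟩
  y 0 + proj₂ (vector (s 0)) + + count (U ≟ˢ_) xs
    ≡⟨ cong (λ x → y 0 + proj₂ (vector x) + + count (U ≟ˢ_) xs) (agree Fin.zero) ⟩
  y 0 + proj₂ (vector x) + + count (U ≟ˢ_) xs
    ≡⟨ ℤ.+-assoc (y 0) _ _ ⟩
  y 0 + (proj₂ (vector x) + + count (U ≟ˢ_) xs)
    ≡⟨ cong (_+_ (y 0)) (head x) ⟩
  y 0 + + count (U ≟ˢ_) (x ∷ xs)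
    ∎
  where
  open ≡-Reasoning
  head : ∀ x → proj₂ (vector x) + + count (U ≟ˢ_) xs ≡ + count (U ≟ˢ_) (x ∷ xs)
  head R = refl
  head U = refl

vector-x≥0 : ∀ s → 0ℤ ℤ.≤ proj₁ (vector s)
vector-x≥0 R = ℤ.+≤+ ℕ.z≤n
vector-x≥0 U = ℤ.+≤+ ℕ.z≤n

vector-y≥0 : ∀ s → 0ℤ ℤ.≤ proj₂ (vector s)
vector-y≥0 R = ℤ.+≤+ ℕ.z≤n
vector-y≥0 U = ℤ.+≤+ ℕ.z≤n

module Path {k n : ℕ} .{{_ : NonZero n}} (k≤n : k ≤ n) (P : LatticePath k n) where
  open LatticePath P
  open ≡-Reasoning

  point-suc : ∀ i → point P (1ℤ + i) ≡ point P i +ₚ vector (step P (1ℤ + i))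
  point-suc (+ m)          = refl
  point-suc -[1+ zero ]    = sym (-ₚ-+ₚ (point P 0ℤ) (vector (step P 0ℤ)))
  point-suc -[1+ suc m ]   = sym (-ₚ-+ₚ (point P -[1+ m ]) (vector (step P -[1+ m ])))

  -- Each step raises the coordinate sum by one. Hence the width after `n` steps follows from the
  -- height, which counts the up steps.
  point-diagonal : ∀ i → proj₁ (point P i) + proj₂ (point P i) ≡ i
  point-diagonal = ℤ-induction _ refl
    (λ i ih → trans (next i) (cong ℤ.suc ih))
    (λ i ih → +-cancelˡ 1ℤ _ _ (trans (sym (next i)) ih))
    where
    diagonal : ∀ x y s → (x + proj₁ (vector s)) + (y + proj₂ (vector s)) ≡ 1ℤ + (x + y)
    diagonal x y R = lemma x y
      where
      lemma : ∀ x y → (x + 1ℤ) + (y + 0ℤ) ≡ 1ℤ + (x + y)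
      lemma = solve-∀
    diagonal x y U = lemma x y
      where
      lemma : ∀ x y → (x + 0ℤ) + (y + 1ℤ) ≡ 1ℤ + (x + y)
      lemma = solve-∀
    next : ∀ i → proj₁ (point P (1ℤ + i)) + proj₂ (point P (1ℤ + i))
               ≡ 1ℤ + (proj₁ (point P i) + proj₂ (point P i))
    next i = trans (cong (λ (x , y) → x + y) (point-suc i))
               (diagonal (proj₁ (point P i)) (proj₂ (point P i)) (step P (1ℤ + i)))

  point-n : point P (+ n) ≡ period P
  point-n = cong₂ _,_ width height
    where
    height : proj₂ (point P (+ n)) ≡ + k
    height = trans
      (height-count steps (λ m → proj₂ (point P (+ m))) (λ m → step P (+ suc m)) (λ _ → refl)
        (λ j → cong (lookup steps) (residue-label j)))
      (cong +_ ups)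
    width : proj₁ (point P (+ n)) ≡ + (n ∸ k)
    width = +-cancelʳ (+ k) _ _ (begin
      proj₁ (point P (+ n)) + + k                     ≡⟨ cong (_+_ (proj₁ (point P (+ n)))) height ⟨
      proj₁ (point P (+ n)) + proj₂ (point P (+ n))   ≡⟨ point-diagonal (+ n) ⟩
      + n                                             ≡⟨ cong +_ (ℕ.m∸n+n≡m k≤n) ⟨
      + (n ∸ k) + + k                                 ∎)

  step-shift : ∀ t i → step P (i + t * + n) ≡ step P i
  step-shift t i = cong (lookup steps) (residue-shift t i)

  point-periodic : ∀ i → point P (i + + n) ≡ point P i +ₚ period P
  point-periodic = ℤ-induction _
    (trans point-n (sym (cong₂ _,_ (ℤ.+-identityˡ _) (ℤ.+-identityˡ _))))
    (λ i ih → trans (next i) (trans (cong (_+ₚ vector (step P (1ℤ + i))) ih)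
                (trans (+ₚ-swap (point P i) _ _) (cong (_+ₚ period P) (sym (point-suc i))))))
    (λ i ih → +ₚ-cancelʳ (trans (sym (next i)) (trans ih
                (trans (cong (_+ₚ period P) (point-suc i)) (+ₚ-swap (point P i) _ _)))))
    where
    +ₚ-cancelʳ : ∀ {p q v} → p +ₚ v ≡ q +ₚ v → p ≡ q
    +ₚ-cancelʳ {v = x , y} eq = cong₂ _,_ (+-cancelʳ x _ _ (cong proj₁ eq)) (+-cancelʳ y _ _ (cong proj₂ eq))
    next : ∀ i → point P (1ℤ + i + + n) ≡ point P (i + + n) +ₚ vector (step P (1ℤ + i))
    next i = begin
      point P (1ℤ + i + + n)
        ≡⟨ cong (point P) (ℤ.+-assoc 1ℤ i (+ n)) ⟩
      point P (1ℤ + (i + + n))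
        ≡⟨ point-suc (i + + n) ⟩
      point P (i + + n) +ₚ vector (step P (1ℤ + (i + + n)))
        ≡⟨ cong (λ j → point P (i + + n) +ₚ vector (step P j)) (shift i (+ n)) ⟩
      point P (i + + n) +ₚ vector (step P (1ℤ + i + 1ℤ * + n))
        ≡⟨ cong (λ s → point P (i + + n) +ₚ vector s) (step-shift 1ℤ (1ℤ + i)) ⟩
      point P (i + + n) +ₚ vector (step P (1ℤ + i))
        ∎
      where
      shift : ∀ i n → 1ℤ + (i + n) ≡ 1ℤ + i + 1ℤ * n
      shift = solve-∀

  start : ℤ → Point
  start i = point P (i - 1ℤ)

  sx sy : ℤ → ℤ
  sx i = proj₁ (start i)
  sy i = proj₂ (start i)

  start-suc : ∀ i → start (1ℤ + i) ≡ start i +ₚ vector (step P i)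
  start-suc i = begin
    point P (1ℤ + i - 1ℤ)                             ≡⟨ cong (point P) (ℤ.+-assoc 1ℤ i -1ℤ) ⟩
    point P (1ℤ + (i - 1ℤ))                           ≡⟨ point-suc (i - 1ℤ) ⟩
    start i +ₚ vector (step P (1ℤ + (i - 1ℤ)))        ≡⟨ cong (λ j → start i +ₚ vector (step P j)) (1+[i-1]≡i i) ⟩
    start i +ₚ vector (step P i)                      ∎

  start-shift : ∀ t i → start (i + t * + n) ≡ start i +ₚ t ·ₚ period P
  start-shift t i = ℤ-induction (λ t → start (i + t * + n) ≡ start i +ₚ t ·ₚ period P)
    (trans (cong start (i+0*j≡i i (+ n))) (sym (cong₂ _,_ (i+0*j≡i (sx i) w) (i+0*j≡i (sy i) h))))
    (λ t ih → trans (next t) (trans (cong (_+ₚ period P) ih) (suc*ₚ t)))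
    (λ t ih → cong₂ _,_ (+-cancelʳ w _ _ (cong proj₁ (trans (sym (next t)) (trans ih (sym (suc*ₚ t))))))
                  (+-cancelʳ h _ _ (cong proj₂ (trans (sym (next t)) (trans ih (sym (suc*ₚ t)))))))
    t
    where
    w = proj₁ (period P)
    h = proj₂ (period P)
    suc*ₚ : ∀ t → start i +ₚ t ·ₚ period P +ₚ period P ≡ start i +ₚ (1ℤ + t) ·ₚ period P
    suc*ₚ t = cong₂ _,_ (i+t*j+j≡i+[1+t]*j (sx i) t w) (i+t*j+j≡i+[1+t]*j (sy i) t h)
    shift : ∀ i t n → i + (1ℤ + t) * n - 1ℤ ≡ i + t * n - 1ℤ + n
    shift = solve-∀
    next : ∀ t → start (i + (1ℤ + t) * + n) ≡ start (i + t * + n) +ₚ period P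
    next t = trans (cong (point P) (shift i t (+ n))) (point-periodic (i + t * + n - 1ℤ))

  start-mono : ∀ {i j} → i ℤ.≤ j → sx i ℤ.≤ sx j × sy i ℤ.≤ sy j
  start-mono {i} {j} i≤j =
    subst (λ j → sx i ℤ.≤ sx j × sy i ℤ.≤ sy j)
      (trans (cong (_+ i) (ℤ.0≤i⇒+∣i∣≡i (ℤ.i≤j⇒0≤j-i i≤j))) (lemma i j)) (go ∣ j - i ∣)
    where
    lemma : ∀ i j → j - i + i ≡ j
    lemma = solve-∀
    increase : ∀ {x y z} → x ℤ.≤ y → 0ℤ ℤ.≤ z → x ℤ.≤ y + z
    increase x≤y 0≤z = subst (ℤ._≤ _) (ℤ.+-identityʳ _) (ℤ.+-mono-≤ x≤y 0≤z)
    go : ∀ m → sx i ℤ.≤ sx (+ m + i) × sy i ℤ.≤ sy (+ m + i)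
    go zero    = subst (λ j → sx i ℤ.≤ sx j × sy i ℤ.≤ sy j) (sym (ℤ.+-identityˡ i))
                   (ℤ.≤-refl , ℤ.≤-refl)
    go (suc m) rewrite ℤ.suc-+ m i | start-suc (+ m + i) =
      increase (proj₁ (go m)) (vector-x≥0 (step P (+ m + i))) ,
      increase (proj₂ (go m)) (vector-y≥0 (step P (+ m + i)))

  start-step : ∀ i {s} → step P i ≡ s → start (1ℤ + i) ≡ start i +ₚ vector s
  start-step i eq = trans (start-suc i) (cong (λ s → start i +ₚ vector s) eq)

  sx-R : ∀ i → step P i ≡ R → sx (1ℤ + i) ≡ 1ℤ + sx i
  sx-R i eq = trans (cong proj₁ (start-step i eq)) (ℤ.+-comm (sx i) 1ℤ)

  sy-R : ∀ i → step P i ≡ R → sy (1ℤ + i) ≡ sy i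
  sy-R i eq = trans (cong proj₂ (start-step i eq)) (ℤ.+-identityʳ (sy i))

  sx-U : ∀ i → step P i ≡ U → sx (1ℤ + i) ≡ sx i
  sx-U i eq = trans (cong proj₁ (start-step i eq)) (ℤ.+-identityʳ (sx i))

  sy-U : ∀ i → step P i ≡ U → sy (1ℤ + i) ≡ 1ℤ + sy i
  sy-U i eq = trans (cong proj₂ (start-step i eq)) (ℤ.+-comm (sy i) 1ℤ)

  sx-strict : ∀ i j → step P i ≡ R → i ℤ.< j → sx i ℤ.< sx j
  sx-strict i j stepᵢ i<j =
    ℤ.suc[i]≤j⇒i<j (subst (ℤ._≤ _) (sx-R i stepᵢ) (proj₁ (start-mono (ℤ.i<j⇒suc[i]≤j i<j))))

  sy-strict : ∀ i j → step P i ≡ U → i ℤ.< j → sy i ℤ.< sy j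
  sy-strict i j stepᵢ i<j =
    ℤ.suc[i]≤j⇒i<j (subst (ℤ._≤ _) (sy-U i stepᵢ) (proj₂ (start-mono (ℤ.i<j⇒suc[i]≤j i<j))))

  column-unique : ∀ i j → step P i ≡ R → step P j ≡ R → sx i ≡ sx j → i ≡ j
  column-unique i j stepᵢ stepⱼ eq with ℤ.<-cmp i j
  ... | tri< i<j _ _ = contradiction eq (ℤ.<⇒≢ (sx-strict i j stepᵢ i<j))
  ... | tri≈ _ i≡j _ = i≡j
  ... | tri> _ _ j<i = contradiction (sym eq) (ℤ.<⇒≢ (sx-strict j i stepⱼ j<i))

  row-unique : ∀ i j → step P i ≡ U → step P j ≡ U → sy i ≡ sy j → i ≡ j
  row-unique i j stepᵢ stepⱼ eq with ℤ.<-cmp i j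
  ... | tri< i<j _ _ = contradiction eq (ℤ.<⇒≢ (sy-strict i j stepᵢ i<j))
  ... | tri≈ _ i≡j _ = i≡j
  ... | tri> _ _ j<i = contradiction (sym eq) (ℤ.<⇒≢ (sy-strict j i stepⱼ j<i))

  sx-reflects-< : ∀ i j → sx i ℤ.< sx j → i ℤ.< j
  sx-reflects-< i j lt = ℤ.≰⇒> λ j≤i → ℤ.<⇒≱ lt (proj₁ (start-mono j≤i))

  sy-reflects-< : ∀ i j → sy i ℤ.< sy j → i ℤ.< j
  sy-reflects-< i j lt = ℤ.≰⇒> λ j≤i → ℤ.<⇒≱ lt (proj₂ (start-mono j≤i))

-- The strip

module Strip {k n : ℕ} .{{_ : NonZero n}} (k≤n : k ≤ n) (P : LatticePath k n) where
  open Path k≤n P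

  -- The strip condition, with the same index for both boundary edges of the column.
  record InColumn (a b : ℤ) : Set where
    constructor column
    field
      index : ℤ
      isR   : step P index ≡ R
      at    : sx index ≡ a
      above : sy index ℤ.≤ b
      below : 1ℤ + b ℤ.≤ sy index + + k
  open InColumn

  strip⇒column : ∀ {a b} → InStrip P (a , b) → InColumn a b
  strip⇒column {a} {b} ((i , h , eqᵢ , h≤b) , (j , h′ , eqⱼ , b+1≤h′)) = column j stepⱼ atⱼ
    (subst (ℤ._≤ b) (trans (sym (cong (proj₂ ∘ proj₂) eqᵢ)) (cong sy i≡j)) h≤b)
    (subst₂ ℤ._≤_ (ℤ.+-comm b 1ℤ) (sym (cong (proj₂ ∘ proj₂) eqⱼ)) b+1≤h′)
    where
    stepⱼ = cong proj₁ eqⱼ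
    atⱼ : sx j ≡ a
    atⱼ = trans (sym (ℤ.+-identityʳ (sx j))) (cong (proj₁ ∘ proj₂) eqⱼ)
    i≡j : i ≡ j
    i≡j = column-unique i j (cong proj₁ eqᵢ) stepⱼ (trans (cong (proj₁ ∘ proj₂) eqᵢ) (sym atⱼ))

  column⇒strip : ∀ {a b} → InColumn a b → InStrip P (a , b)
  column⇒strip {a} {b} (column i stepᵢ atᵢ above below) =
    (i , sy i , cong₂ _,_ stepᵢ (cong₂ _,_ atᵢ refl) , above) ,
    (i , sy i + + k , cong₂ _,_ stepᵢ (cong₂ _,_ (trans (ℤ.+-identityʳ (sx i)) atᵢ) refl) ,
      subst (ℤ._≤ _) (ℤ.+-comm 1ℤ b) below)

  strip-shift : ∀ t {B} → InStrip P B → InStrip P (B +ₚ t ·ₚ period P)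
  strip-shift t {a , b} st with strip⇒column st
  ... | column i stepᵢ atᵢ above below = column⇒strip (column (i + t * + n)
    (trans (step-shift t i) stepᵢ)
    (trans (cong proj₁ (start-shift t i)) (cong (_+ t * + (n ∸ k)) atᵢ))
    (subst (ℤ._≤ b + t * + k) (sym (cong proj₂ (start-shift t i))) (ℤ.+-monoˡ-≤ (t * + k) above))
    (subst₂ ℤ._≤_ (ℤ.+-assoc 1ℤ b (t * + k))
      (trans (lemma (sy i) (+ k) (t * + k)) (cong (_+ + k) (sym (cong proj₂ (start-shift t i)))))
      (ℤ.+-monoˡ-≤ (t * + k) below)))
    where
    lemma : ∀ y k x → y + k + x ≡ y + x + k
    lemma = solve-∀

  -- For `k = 0` the two boundaries coincide and leave no room for a box.
  k≢0 : ∀ {a b} → InColumn a b → NonZero k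
  k≢0 {a} {b} (column i _ _ above below) = ℕ.≢-nonZero λ k≡0 →
    1+i≰i (ℤ.≤-trans below (subst (ℤ._≤ b)
      (trans (sym (ℤ.+-identityʳ (sy i))) (cong (λ k → sy i + + k) (sym k≡0))) above))

  -- The barrier of the backward induction: left of this `i`, the strip lies below row `b`.
  northern-low : NonZero k → ∀ b → ∃[ i ] sy i + + k ℤ.≤ b
  -- Step `1` starts at the origin. Going back `∣ b ∣` periods lowers the boundary by at least
  -- `∣ b ∣`, and one more period cancels the offset `k` of the northern boundary.
  northern-low k≢0 b = 1ℤ + t * + n , (begin
    sy (1ℤ + t * + n) + + k    ≡⟨ cong (λ p → proj₂ p + + k) (start-shift t 1ℤ) ⟩
    0ℤ + t * + k + + k         ≡⟨ lemma (+ ∣ b ∣) (+ k) ⟩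
    ℤ.- (+ ∣ b ∣ * + k)        ≤⟨ ℤ.neg-mono-≤
                                    (subst (+ ∣ b ∣ ℤ.≤_) (ℤ.pos-* ∣ b ∣ k) (ℤ.+≤+ (ℕ.m≤m*n ∣ b ∣ k {{k≢0}}))) ⟩
    ℤ.- (+ ∣ b ∣)              ≤⟨ -∣i∣≤i b ⟩
    b                          ∎)
    where
    open ℤ.≤-Reasoning
    t = ℤ.- (1ℤ + + ∣ b ∣)
    lemma : ∀ c k → 0ℤ + ℤ.- (1ℤ + c) * k + k ≡ ℤ.- (c * k)
    lemma = solve-∀

  -- Follow the northern boundary backwards from its edge above the column.
  leftwards : ∀ {a b} d j → sx (1ℤ + j) ≡ a → sy (1ℤ + j) + + k ≡ 1ℤ + b + + d → sy (1ℤ + j) ℤ.≤ b →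
    (∃[ i ] northern P i ≡ left (a , b)) ⊎
    (Σ[ c ∈ InColumn (a - 1ℤ) b ] sy (index c) ℤ.≤ sy (1ℤ + j))
  leftwards {a} {b} d j x≡ y≡ y≤ with step P j in eq
  ... | R = inj₂ (column j eq (lemma (trans (sym (sx-R j eq)) x≡))
                   (subst (ℤ._≤ b) (sy-R j eq) y≤)
                   (subst (1ℤ + b ℤ.≤_) (trans (sym y≡) (cong (_+ + k) (sy-R j eq))) (ℤ.i≤i+j (1ℤ + b) (+ d)))
                 , ℤ.≤-reflexive (sym (sy-R j eq)))
    where
    lemma : ∀ {x a} → 1ℤ + x ≡ a → x ≡ a - 1ℤ
    lemma {x} refl = identity x
      where
      identity : ∀ x → x ≡ 1ℤ + x - 1ℤ
      identity = solve-∀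
  leftwards {a} {b} zero j x≡ y≡ y≤ | U = inj₁ (j , cong₂ _,_ eq (cong₂ _,_
    (trans (ℤ.+-identityʳ (sx j)) (trans (sym (sx-U j eq)) x≡))
    (+-cancelˡ 1ℤ _ _ (trans (sym (ℤ.+-assoc 1ℤ (sy j) (+ k)))
      (trans (cong (_+ + k) (sym (sy-U j eq))) (trans y≡ (ℤ.+-identityʳ (1ℤ + b))))))))
  leftwards {a} {b} (suc d) j x≡ y≡ y≤ | U
    with leftwards {a} {b} d (j - 1ℤ)
           (trans (cong sx (1+[i-1]≡i j)) (trans (sym (sx-U j eq)) x≡))
           (trans (cong (λ i → sy i + + k) (1+[i-1]≡i j)) (+-cancelˡ 1ℤ _ _ (trans (sym (ℤ.+-assoc 1ℤ (sy j) (+ k)))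
             (trans (cong (_+ + k) (sym (sy-U j eq))) (trans y≡ (swap b (+ d)))))))
           (ℤ.≤-trans (subst (λ i → sy (1ℤ + (j - 1ℤ)) ℤ.≤ sy i) (cong ℤ.suc (1+[i-1]≡i j)) lower) y≤)
    where
    swap : ∀ b d → 1ℤ + b + (1ℤ + d) ≡ 1ℤ + (1ℤ + b + d)
    swap = solve-∀
    lower : sy (1ℤ + (j - 1ℤ)) ℤ.≤ sy (1ℤ + (1ℤ + (j - 1ℤ)))
    lower = proj₂ (start-mono (ℤ.i≤suc[i] (1ℤ + (j - 1ℤ))))
  ... | inj₁ found    = inj₁ found
  ... | inj₂ (c , le) = inj₂ (c , ℤ.≤-trans le
    (proj₂ (start-mono (subst (ℤ._≤ 1ℤ + j) (sym (1+[i-1]≡i j)) (ℤ.i≤suc[i] j)))))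

  -- The inequality in the second case keeps the height bound intact when the backward induction
  -- moves left.
  left-cases : ∀ {a b} (c : InColumn a b) →
    (∃[ i ] northern P i ≡ left (a , b)) ⊎
    (Σ[ c′ ∈ InColumn (a - 1ℤ) b ] sy (index c′) ℤ.≤ sy (index c))
  left-cases {a} {b} (column i stepᵢ atᵢ above below) =
    subst (λ i′ → (∃[ i ] northern P i ≡ left (a , b)) ⊎
                  (Σ[ c′ ∈ InColumn (a - 1ℤ) b ] sy (index c′) ℤ.≤ sy i′)) (1+[i-1]≡i i)
      -- The distance from the top of the box up to the northern boundary: so many up steps can be
      -- undone before the next one is the left side of the box.
      (leftwards ∣ sy i + + k - (1ℤ + b) ∣ (i - 1ℤ)
        (trans (cong sx (1+[i-1]≡i i)) atᵢ)
        (trans (cong (λ i → sy i + + k) (1+[i-1]≡i i)) (trans (split (1ℤ + b) (sy i + + k))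
          (cong (_+_ (1ℤ + b)) (sym (ℤ.0≤i⇒+∣i∣≡i (ℤ.i≤j⇒0≤j-i below))))))
        (subst (ℤ._≤ b) (cong sy (sym (1+[i-1]≡i i))) above))
    where
    split : ∀ x y → y ≡ x + (y - x)
    split = solve-∀

  top-cases : ∀ {a b} (c : InColumn a b) →
    (∃[ i ] northern P i ≡ top (a , b)) ⊎ (Σ[ c′ ∈ InColumn a (b + 1ℤ) ] index c′ ≡ index c)
  top-cases {a} {b} (column i stepᵢ atᵢ above below) with 1ℤ + b ℤ.≟ sy i + + k
  ... | yes eq = inj₁ (i , cong₂ _,_ stepᵢ (cong₂ _,_ (cong (_+ 0ℤ) atᵢ) (trans (sym eq) (ℤ.+-comm 1ℤ b))))
  ... | no neq = inj₂ (column i stepᵢ atᵢ (ℤ.≤-trans above (ℤ.i≤i+j b 1ℤ))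
    (subst (λ x → 1ℤ + x ℤ.≤ sy i + + k) (ℤ.+-comm 1ℤ b) (ℤ.i<j⇒suc[i]≤j (ℤ.≤∧≢⇒< below neq))) , refl)

  northern-injective : ∀ i j → northern P i ≡ northern P j → i ≡ j
  northern-injective i j eq = go (step P i) refl
    where
    go : ∀ s → step P i ≡ s → i ≡ j
    go R stepᵢ = column-unique i j stepᵢ (trans (sym (cong proj₁ eq)) stepᵢ)
                   (+-cancelʳ 0ℤ _ _ (cong (proj₁ ∘ proj₂) eq))
    go U stepᵢ = row-unique i j stepᵢ (trans (sym (cong proj₁ eq)) stepᵢ)
                   (+-cancelʳ (+ k) _ _ (cong (proj₂ ∘ proj₂) eq))

  -- The northern boundary passes above the box and never descends to the right, so none of its
  -- later edges starts at height `b`.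
  northern≢right : ∀ {a b} i → InColumn a b → northern P i ≢ right (a , b)
  northern≢right {a} {b} i (column j stepⱼ atⱼ above below) eq = 1+i≰i (begin
    1ℤ + b         ≤⟨ below ⟩
    sy j + + k     ≤⟨ ℤ.+-monoˡ-≤ (+ k) (proj₂ (start-mono (ℤ.<⇒≤ j<i))) ⟩
    sy i + + k     ≡⟨ cong (proj₂ ∘ proj₂) eq ⟩
    b + 0ℤ         ≡⟨ ℤ.+-identityʳ b ⟩
    b              ∎)
    where
    open ℤ.≤-Reasoning
    j<i : j ℤ.< i
    j<i = sx-reflects-< j i (ℤ.suc[i]≤j⇒i<j (ℤ.≤-reflexive
      (trans (cong ℤ.suc atⱼ) (trans (ℤ.+-comm 1ℤ a)
        (trans (sym (cong (proj₁ ∘ proj₂) eq)) (ℤ.+-identityʳ (sx i)))))))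

  northern≢bottom : ∀ {a b} i → InColumn a b → northern P i ≢ bottom (a , b)
  northern≢bottom {a} {b} i (column j stepⱼ atⱼ above below) eq =
    1+i≰i (ℤ.≤-trans below (ℤ.≤-reflexive (trans (cong (λ i → sy i + + k) j≡i) (cong (proj₂ ∘ proj₂) eq))))
    where
    j≡i : j ≡ i
    j≡i = column-unique j i stepⱼ (cong proj₁ eq)
            (trans atⱼ (trans (sym (cong (proj₁ ∘ proj₂) eq)) (ℤ.+-identityʳ (sx i))))

  northern≢exit : ∀ i τ s {B} → InStrip P B → northern P i ≢ exit τ s B
  northern≢exit i crossing U st = northern≢right i (strip⇒column st)
  northern≢exit i crossing R st = northern≢bottom i (strip⇒column st)
  northern≢exit i elbow    U st = northern≢bottom i (strip⇒column st)
  northern≢exit i elbow    R st = northern≢right i (strip⇒column st)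

-- Strands

entry : Step → Box → UnitEdge
entry U = left
entry R = top

entry-entered : ∀ e → entry (proj₁ e) (entered e) ≡ e
entry-entered (U , p) = refl
entry-entered (R , p) = cong (R ,_) (-ₚ-+ₚ p (vector U))

entered-entry : ∀ s B → entered (entry s B) ≡ B
entered-entry U B = refl
entered-entry R B = +ₚ--ₚ B (vector U)

direction-entry : ∀ s B → proj₁ (entry s B) ≡ s
direction-entry U B = refl
direction-entry R B = refl

-- The backward analogue of `entered`: the box just left through an edge is known without knowing
-- its tile.
exited : UnitEdge → Box
exited (U , p) = p -ₚ vector R
exited (R , p) = p

exited-exit : ∀ τ s B → exited (exit τ s B) ≡ B
exited-exit crossing U B = +ₚ--ₚ B (vector R)
exited-exit crossing R B = refl
exited-exit elbow    U B = refl
exited-exit elbow    R B = +ₚ--ₚ B (vector R)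

exit-direction-injective : ∀ τ s s′ B → exit τ s B ≡ exit τ s′ B → s ≡ s′
exit-direction-injective _        U U B eq = refl
exit-direction-injective _        R R B eq = refl
exit-direction-injective crossing U R B eq = case cong proj₁ eq of λ ()
exit-direction-injective crossing R U B eq = case cong proj₁ eq of λ ()
exit-direction-injective elbow    U R B eq = case cong proj₁ eq of λ ()
exit-direction-injective elbow    R U B eq = case cong proj₁ eq of λ ()

translate : Point → UnitEdge → UnitEdge
translate v (s , p) = s , p +ₚ v

entry-translate : ∀ s v B → translate v (entry s B) ≡ entry s (B +ₚ v)
entry-translate U v B = refl
entry-translate R v B = cong (R ,_) (+ₚ-swap B (vector U) v)

exit-translate : ∀ τ s v B → translate v (exit τ s B) ≡ exit τ s (B +ₚ v)
exit-translate crossing U v B = cong (U ,_) (+ₚ-swap B (vector R) v)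
exit-translate crossing R v B = refl
exit-translate elbow    U v B = refl
exit-translate elbow    R v B = cong (U ,_) (+ₚ-swap B (vector R) v)

module Strands {k n : ℕ} .{{_ : NonZero n}} (k≤n : k ≤ n) (P : LatticePath k n) (A : Filling P) where
  open Path k≤n P
  open Strip k≤n P
  open InColumn
  open Filling A

  pass-entry : ∀ s {B i Bs} → Strand P A i Bs (entry s B) → InStrip P B →
               Strand P A i (B ∷ Bs) (exit (tile B) s B)
  pass-entry s {B} {i} {Bs} str st =
    subst₂ (λ B′ s′ → Strand P A i (B′ ∷ Bs) (exit (tile B′) s′ B′))
      (entered-entry s B) (direction-entry s B)
      (pass str (subst (InStrip P) (sym (entered-entry s B)) st))

  -- Strands can be traced backwards: an edge determines the box left through it, and the tile there
  -- determines the side of entry. Northern edges are never exits of boxes in the strip, so both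
  -- traces stop together, at the same northern edge.
  strand-unique : ∀ {i j Bs Cs e e′} → Strand P A i Bs e → Strand P A j Cs e′ → e ≡ e′ → i ≡ j
  strand-unique {i} {j} enter enter eq = northern-injective i j eq
  strand-unique {i} enter (pass {e = e′} _ st) eq =
    contradiction eq (northern≢exit i (tile (entered e′)) (proj₁ e′) st)
  strand-unique {j = j} (pass {e = e} _ st) enter eq =
    contradiction (sym eq) (northern≢exit j (tile (entered e)) (proj₁ e) st)
  strand-unique (pass {e = e} str _) (pass {e = e′} str′ _) eq = strand-unique str str′ (begin
    e                               ≡⟨ entry-entered e ⟨
    entry (proj₁ e) (entered e)     ≡⟨ cong₂ entry same-direction same-box ⟩
    entry (proj₁ e′) (entered e′)   ≡⟨ entry-entered e′ ⟩
    e′                              ∎)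
    where
    open ≡-Reasoning
    same-box : entered e ≡ entered e′
    same-box = trans (sym (exited-exit (tile (entered e)) (proj₁ e) (entered e)))
                 (trans (cong exited eq) (exited-exit (tile (entered e′)) (proj₁ e′) (entered e′)))
    same-direction : proj₁ e ≡ proj₁ e′
    same-direction = exit-direction-injective (tile (entered e)) _ _ (entered e)
      (trans eq (cong (λ B → exit (tile B) (proj₁ e′) B) (sym same-box)))

  tile-shift : ∀ t {B} → InStrip P B → tile (B +ₚ t ·ₚ period P) ≡ tile B
  tile-shift t {B@(a , b)} st = ℤ-induction (λ t → tile (B +ₚ t ·ₚ period P) ≡ tile B)
    (cong tile (cong₂ _,_ (i+0*j≡i a w) (i+0*j≡i b h)))
    (λ t ih → trans (next t) ih) (λ t ih → trans (sym (next t)) ih) t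
    where
    w = proj₁ (period P)
    h = proj₂ (period P)
    next : ∀ t → tile (B +ₚ (1ℤ + t) ·ₚ period P) ≡ tile (B +ₚ t ·ₚ period P)
    next t = trans (cong tile (cong₂ _,_ (sym (i+t*j+j≡i+[1+t]*j a t w)) (sym (i+t*j+j≡i+[1+t]*j b t h))))
                   (periodic (B +ₚ t ·ₚ period P) (strip-shift t st))

  northern-shift : ∀ t i → translate (t ·ₚ period P) (northern P i) ≡ northern P (i + t * + n)
  northern-shift t i = cong₂ _,_ (sym (step-shift t i))
    (trans (+ₚ-swap (start i) (0ℤ , + k) (t ·ₚ period P)) (cong (_+ₚ (0ℤ , + k)) (sym (start-shift t i))))

  strand-shift : ∀ t {i Bs e} → Strand P A i Bs e →
                 ∃[ Cs ] Strand P A (i + t * + n) Cs (translate (t ·ₚ period P) e)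
  strand-shift t {i} enter = [] , subst (Strand P A (i + t * + n) []) (sym (northern-shift t i)) enter
  strand-shift t {i} (pass {e = e} str st) with strand-shift t str
  ... | Cs , str′ = B +ₚ v ∷ Cs , subst (Strand P A (i + t * + n) (B +ₚ v ∷ Cs))
      (trans (cong (λ τ → exit τ s (B +ₚ v)) (tile-shift t st)) (sym (exit-translate (tile B) s v B)))
      (pass-entry s (subst (Strand P A (i + t * + n) Cs)
        (trans (cong (translate v) (sym (entry-entered e))) (entry-translate s v B)) str′) (strip-shift t st))
    where
    v = t ·ₚ period P
    s = proj₁ e
    B = entered e

  -- The Deograph: edges modulo translation and their endpoints

  G : Multigraph (Fin n)
  G = deograph P A
  open Multigraph G using (Joins; _≈_)

  ≈-sym : ∀ {E E′} → E ≈ E′ → E′ ≈ E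
  ≈-sym {E} {E′} (t , eq) = ℤ.- t , trans (undo (Elbow.box E) (period P)) (cong (_+ₚ (ℤ.- t) ·ₚ period P) (sym eq))
    where
    undo : ∀ p v → p ≡ p +ₚ t ·ₚ v +ₚ (ℤ.- t) ·ₚ v
    undo (a , b) (x , y) = cong₂ _,_ (lemma a x t) (lemma b y t)
      where
      lemma : ∀ a x t → a ≡ a + t * x + (ℤ.- t) * x
      lemma = solve-∀

  ≈-trans : ∀ {E E′ E″} → E ≈ E′ → E′ ≈ E″ → E ≈ E″
  ≈-trans {E} (t , eq) (u , eq′) = t + u ,
    trans eq′ (trans (cong (_+ₚ u ·ₚ period P) eq) (add (Elbow.box E) (period P)))
    where
    add : ∀ p v → p +ₚ t ·ₚ v +ₚ u ·ₚ v ≡ p +ₚ (t + u) ·ₚ v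
    add (a , b) (x , y) = cong₂ _,_ (lemma a x t u) (lemma b y t u)
      where
      lemma : ∀ a x t u → a + t * x + u * x ≡ a + (t + u) * x
      lemma = solve-∀

  joins-≈ : ∀ {E E′ u v} → E ≈ E′ → Joins E u v → Joins E′ u v
  joins-≈ {E} {E′} {u} {v} (t , eq) (i , j , _ , _ , strᵢ , strⱼ , ends) =
    i + t * + n , j + t * + n , _ , _ , enters U strᵢ , enters R strⱼ ,
    subst₂ (λ x y → (u ≡ x × v ≡ y) ⊎ (u ≡ y × v ≡ x)) (sym (residue-shift t i)) (sym (residue-shift t j)) ends
    where
    enters : ∀ s {i Bs} (str : Strand P A i Bs (entry s (Elbow.box E))) →
             Strand P A (i + t * + n) (proj₁ (strand-shift t str)) (entry s (Elbow.box E′))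
    enters s str = subst (Strand P A _ _)
      (trans (entry-translate s (t ·ₚ period P) (Elbow.box E)) (cong (entry s) (sym eq)))
      (proj₂ (strand-shift t str))

  joins-unique : ∀ {E u v i j Bs Cs} → Joins E u v →
    Strand P A i Bs (left (Elbow.box E)) → Strand P A j Cs (top (Elbow.box E)) →
    (residue i , residue j) ≡ (u , v) ⊎ (residue i , residue j) ≡ (v , u)
  joins-unique (i , j , _ , _ , strᵢ , strⱼ , ends) strᵢ′ strⱼ′
    with refl ← strand-unique strᵢ strᵢ′ refl | refl ← strand-unique strⱼ strⱼ′ refl with ends
  ... | inj₁ (refl , refl) = inj₁ refl
  ... | inj₂ (refl , refl) = inj₂ refl

  joins-sym : ∀ {E u v} → Joins E u v → Joins E v u
  joins-sym (i , j , Bs , Cs , strᵢ , strⱼ , inj₁ (p , q)) = i , j , Bs , Cs , strᵢ , strⱼ , inj₂ (q , p)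
  joins-sym (i , j , Bs , Cs , strᵢ , strⱼ , inj₂ (p , q)) = i , j , Bs , Cs , strᵢ , strⱼ , inj₁ (q , p)

  connected-sym : ∀ {u v} → Connected G u v → Connected G v u
  connected-sym = Star.reverse (λ (e , joins) → e , joins-sym {e} joins)

  -- The label of the strand that would pass through the edge if all boxes were
  -- crossings. A row meets the southern boundary at an index n larger than the
  -- northern one, which is the same residue.
  Label : UnitEdge → Fin n → Set
  Label (R , (a , h)) v = ∃[ j ] step P j ≡ R × sx j ≡ a × residue j ≡ v
  Label (U , (a , b)) v = ∃[ j ] step P j ≡ U × sy j + + k ≡ b × residue j ≡ v

  label-bottom : ∀ B {v} → Label (top B) v → Label (bottom B) v
  label-bottom (a , b) (j , stepⱼ , atⱼ , res) = j , stepⱼ , trans atⱼ (ℤ.+-identityʳ a) , res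

  label-right : ∀ B {v} → Label (left B) v → Label (right B) v
  label-right (a , b) (j , stepⱼ , atⱼ , res) = j , stepⱼ , trans atⱼ (sym (ℤ.+-identityʳ b)) , res

  label-northern : ∀ j → Label (northern P j) (residue j)
  label-northern j = go (step P j) refl
    where
    go : ∀ s → step P j ≡ s → Label (s , start j +ₚ (0ℤ , + k)) (residue j)
    go R stepⱼ = j , stepⱼ , sym (ℤ.+-identityʳ (sx j)) , refl
    go U stepⱼ = j , stepⱼ , refl , refl

  label-southern : ∀ j {v} → Label (southern P j) v → v ≡ residue j
  label-southern j = go (step P j) refl
    where
    go : ∀ s {v} → step P j ≡ s → Label (s , start j) v → v ≡ residue j
    go R stepⱼ (i , stepᵢ , atᵢ , refl) = cong residue (column-unique i j stepᵢ stepⱼ atᵢ)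
    go U stepⱼ (i , stepᵢ , atᵢ , refl) = trans (sym (residue-shift 1ℤ i))
      (cong residue (row-unique (i + 1ℤ * + n) j (trans (step-shift 1ℤ i) stepᵢ) stepⱼ
        (trans (cong proj₂ (start-shift 1ℤ i)) (trans (cong (_+_ (sy i)) (ℤ.*-identityˡ (+ k))) atᵢ))))

  Linked : ℤ → UnitEdge → Set
  Linked i e = ∃[ v ] Label e v × Connected G (residue i) v

  -- Existence of the strand belongs to the induction hypothesis, since an elbow joins two labels
  -- only through two actual strands.
  Reached : UnitEdge → Set
  Reached e = ∃[ i ] ∃[ Bs ] Strand P A i Bs e × Linked i e

  -- At an elbow the two strands exchange their labels, but they are adjacent.
  linked-exit : ∀ {B} → InStrip P B → (∀ s → Reached (entry s B)) → ∀ s {i Bs} →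
                Strand P A i Bs (entry s B) → Linked i (entry s B) → Linked i (exit (tile B) s B)
  linked-exit {B} st entries s str (v , ℓ , iv) with tile B in eq
  linked-exit {B} st entries U str (v , ℓ , iv) | crossing = v , label-right B ℓ , iv
  linked-exit {B} st entries R str (v , ℓ , iv) | crossing = v , label-bottom B ℓ , iv
  linked-exit {B} st entries U str (v , ℓ , iv) | elbow with entries R
  ... | j , _ , str′ , w , ℓ′ , jw = w , label-bottom B ℓ′ ,
    (record { box = B ; inStrip = st ; isElbow = eq } , _ , _ , _ , _ , str , str′ , inj₁ (refl , refl)) ◅ jw
  linked-exit {B} st entries R str (v , ℓ , iv) | elbow with entries U
  ... | j , _ , str′ , w , ℓ′ , jw = w , label-right B ℓ′ ,
    (record { box = B ; inStrip = st ; isElbow = eq } , _ , _ , _ , _ , str′ , str , inj₂ (refl , refl)) ◅ jw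

  reached-exits : ∀ {B} → InStrip P B → (∀ s → Reached (entry s B)) → Reached (right B) × Reached (bottom B)
  reached-exits {B} st entries = sort (tile B) (reached U) (reached R)
    where
    reached : ∀ s → Reached (exit (tile B) s B)
    reached s with entries s
    ... | i , Bs , str , linked = i , B ∷ Bs , pass-entry s str st , linked-exit st entries s str linked
    -- The tile only decides which of the two strands takes which side; both sides are always used.
    sort : ∀ τ → Reached (exit τ U B) → Reached (exit τ R B) → Reached (right B) × Reached (bottom B)
    sort crossing x y = x , y
    sort elbow    x y = y , x

  reached-northern : ∀ {e} → (∃[ i ] northern P i ≡ e) → Reached e
  reached-northern (i , refl) = i , [] , enter , residue i , label-northern i , ε

  -- Going up or left decreases x - y by one, and stays under the northern
  -- boundary to the right of its step i₀.
  entries-reached′ : ∀ i₀ H m {a b} (c : InColumn a b) → sy i₀ + + k ℤ.≤ b → sy (index c) + + k ℤ.≤ H →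
    a - b ℤ.≤ sx i₀ - H + + m → ∀ s → Reached (entry s (a , b))
  entries-reached′ i₀ H zero {a} {b} c low high fuel s = contradiction (begin
    1ℤ + (a - b)                    ≤⟨ ℤ.+-monoʳ-≤ 1ℤ fuel ⟩
    1ℤ + (sx i₀ - H + 0ℤ)           ≡⟨ rearrange (sx i₀) H ⟩
    1ℤ + sx i₀ - H                  ≤⟨ ℤ.+-mono-≤ (ℤ.+-monoʳ-≤ 1ℤ x≤a) (ℤ.neg-mono-≤ (ℤ.≤-trans (below c) high)) ⟩
    1ℤ + a - (1ℤ + b)               ≡⟨ cancel a b ⟩
    a - b                           ∎) 1+i≰i
    where
    open ℤ.≤-Reasoning
    rearrange : ∀ x h → 1ℤ + (x - h + 0ℤ) ≡ 1ℤ + x - h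
    rearrange = solve-∀
    cancel : ∀ a b → 1ℤ + a - (1ℤ + b) ≡ a - b
    cancel = solve-∀
    -- The northern boundary is at most at height `b` at `i₀` and at least at `1 + b` above the box,
    -- so `i₀` comes first. This gives `sx i₀ ≤ a`; with `1 + b ≤ H` it shows that the fuel cannot
    -- have run out.
    i₀<c : i₀ ℤ.< index c
    i₀<c = sy-reflects-< i₀ (index c) (ℤ.suc[i]≤j⇒i<j (≤-shift (shift (sy i₀) (sy (index c)) (+ k))
      (ℤ.≤-trans (ℤ.+-monoʳ-≤ 1ℤ low) (below c))))
      where
      shift : ∀ x y k → y + k - (1ℤ + (x + k)) ≡ y - (1ℤ + x)
      shift = solve-∀
    x≤a : sx i₀ ℤ.≤ a
    x≤a = subst (sx i₀ ℤ.≤_) (at c) (proj₁ (start-mono (ℤ.<⇒≤ i₀<c)))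
  entries-reached′ i₀ H (suc m) {a} {b} c low high fuel U with left-cases c
  ... | inj₁ northern = reached-northern northern
  ... | inj₂ (c′ , le) = subst Reached
    (cong (U ,_) (cong₂ _,_ (undo a) (ℤ.+-identityʳ b)))
    (proj₁ (reached-exits (column⇒strip c′)
      (entries-reached′ i₀ H m c′ low (ℤ.≤-trans (ℤ.+-monoˡ-≤ (+ k) le) high)
        (≤-shift (shift (sx i₀ - H) (+ m) a b) fuel))))
    where
    undo : ∀ a → a - 1ℤ + 1ℤ ≡ a
    undo = solve-∀
    shift : ∀ x m a b → x + (1ℤ + m) - (a - b) ≡ x + m - (a - 1ℤ - b)
    shift = solve-∀
  entries-reached′ i₀ H (suc m) {a} {b} c low high fuel R with top-cases c
  ... | inj₁ northern = reached-northern northern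
  ... | inj₂ (c′ , same) = subst Reached
    (cong (R ,_) (cong₂ _,_ (sym (ℤ.+-identityʳ a)) refl))
    (proj₂ (reached-exits (column⇒strip c′)
      (entries-reached′ i₀ H m c′ (ℤ.≤-trans low (ℤ.i≤i+j b 1ℤ))
        (subst (λ i → sy i + + k ℤ.≤ H) (sym same) high)
        (≤-shift (shift (sx i₀ - H) (+ m) a b) fuel))))
    where
    shift : ∀ x m a b → x + (1ℤ + m) - (a - b) ≡ x + m - (a - (b + 1ℤ))
    shift = solve-∀

  entries-reached : ∀ {B} → InStrip P B → ∀ s → Reached (entry s B)
  entries-reached {a , b} st = entries-reached′ i₀ H ∣ d ∣ c (proj₂ low) ℤ.≤-refl
    (≤-shift (identity (+ ∣ d ∣) (a - b) (sx i₀ - H)) (i≤∣i∣ d))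
    where
    c   = strip⇒column st
    low = northern-low (k≢0 c) b
    i₀  = proj₁ low
    -- The height of the northern boundary above the initial column, an upper bound for every box
    -- met while moving up and left.
    H   = sy (index c) + + k
    d   = a - b - (sx i₀ - H)
    identity : ∀ z x y → z - (x - y) ≡ y + z - x
    identity = solve-∀

  strand-linked : ∀ {i Bs e} → Strand P A i Bs e → Linked i e
  strand-linked {i} enter = residue i , label-northern i , ε
  strand-linked {i} (pass {Bs} {e} str st) =
    linked-exit st (entries-reached st) (proj₁ e)
      (subst (Strand P A i Bs) (sym (entry-entered e)) str)
      (subst (Linked i) (sym (entry-entered e)) (strand-linked str))

  strand-connected : ∀ {i} j {Bs} → Strand P A i Bs (southern P j) → Connected G (residue i) (residue j)
  strand-connected {i} j str with strand-linked str
  ... | v , ℓ , iv = subst (Connected G (residue i)) (label-southern j ℓ) iv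

-- Maximal Deograms: equality in the component count

module Maximal {k n : ℕ} .{{_ : NonZero n}} (k≤n : k ≤ n)
  (f : BoundedAffinePermutation k n) (P : LatticePath k n) (A : Filling P)
  (maximal : IsMaximalDeogram f P A) where

  open BoundedAffinePermutation f using (fun; reduced)
  open IsMaximalDeogram maximal
  open IsDeogram isDeogram
  open Strands k≤n P A
  open Multigraph G using (Edge; _≈_; Joins)

  c = proj₁ elbowCount
  cycles = proj₁ (proj₂ elbowCount)
  elbows = proj₂ (proj₂ elbowCount)

  class : Edge → Fin (n ∸ c)
  class E = proj₁ (proj₂ (proj₂ elbows) E)

  representative : Fin (n ∸ c) → Edge
  representative = proj₁ elbows

  representative-≈ : ∀ E → representative (class E) ≈ E
  representative-≈ E = proj₂ (proj₂ (proj₂ elbows) E)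

  class-≈ : ∀ {E E′} → class E ≡ class E′ → E ≈ E′
  class-≈ {E} {E′} eq = ≈-trans {E} {representative (class E)} {E′}
    (≈-sym {representative (class E)} {E} (representative-≈ E))
    (subst (λ p → representative p ≈ E′) (sym eq) (representative-≈ E′))

  entering : ∀ p s → Reached (entry s (Elbow.box (representative p)))
  entering p = entries-reached (Elbow.inStrip (representative p))

  -- An elbow does not come with its strands; `entries-reached` supplies them, and `strand-unique`
  -- makes the choice immaterial.
  ends : Fin (n ∸ c) → Fin n × Fin n
  ends p = residue (proj₁ (entering p U)) , residue (proj₁ (entering p R))

  joins-ends : ∀ {E u v} → Joins E u v → ends (class E) ≡ (u , v) ⊎ ends (class E) ≡ (v , u)
  joins-ends {E} joins = joins-unique {representative (class E)}
    (joins-≈ {E} {representative (class E)} (≈-sym {representative (class E)} {E} (representative-≈ E)) joins)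
    (proj₁ (proj₂ (proj₂ (entering (class E) U))))
    (proj₁ (proj₂ (proj₂ (entering (class E) R))))

  roots : Fin c → Fin n
  roots = proj₁ cycles

  root : ∀ v → ∃[ p ] SameCycle reduced (roots p) v
  root = proj₂ (proj₂ cycles)

  reduced-connected : ∀ v → Connected G v (reduced v)
  reduced-connected v = subst (λ u → Connected G u (reduced v)) (residue-label v)
    (strand-connected (fun (label v)) (proj₂ (strandPermutation (label v))))

  sameCycle⇒connected : ∀ {u v} → SameCycle reduced u v → Connected G u v
  sameCycle⇒connected     (zero  , refl) = ε
  sameCycle⇒connected {u} (suc m , eq)   = reduced-connected u ◅◅ sameCycle⇒connected (m , eq)

  -- Makes `n ∸ c` a true difference. Equal representatives are equivalent by zero iterations and
  -- hence have the same index.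
  c≤n : c ≤ n
  c≤n = Fin.injective⇒≤ {f = roots} λ eq → proj₁ (proj₂ cycles) _ _ (0 , eq)

  root-connected : ∀ v → ∃[ p ] Connected G (roots p) v
  root-connected v = let (p , pv) = root v in p , sameCycle⇒connected pv

  open FewEdges G class (λ {E} {E′} → class-≈ {E} {E′}) ends (λ {E} → joins-ends {E})
    roots root-connected (ℕ.m∸n+n≡m c≤n)
    using (forest; roots-unconnected) public

  -- The representatives of the cycles of `u` and `v` become connected through `u` and `v`, so they
  -- are the same representative.
  connected⇒sameCycle : ∀ {u v} → Connected G u v → SameCycle reduced u v
  connected⇒sameCycle {u} {v} uv =
    let (p , pu) = root u
        (q , qv) = root v
        p≡q = roots-unconnected (sameCycle⇒connected pu ◅◅ uv ◅◅ connected-sym (sameCycle⇒connected qv))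
        injective = λ {u} {v} → reduced-injective f {u} {v}
    in sameCycle-trans injective (sameCycle-sym injective pu)
         (subst (λ r → SameCycle reduced (roots r) v) (sym p≡q) qv)

proposition3p14 : ∀ (k n : ℕ) .{{_ : NonZero n}} → k ≤ n →
    (f : BoundedAffinePermutation k n) (P : LatticePath k n) (A : Filling P) →
    IsMaximalDeogram f P A →
    Forest (deograph P A) ×
    (∀ (S : Pred (Fin n) 0ℓ) →
    IsComponent (deograph P A) S ⇔ IsCycleSupport (BoundedAffinePermutation.reduced f) S)
proposition3p14 k n k≤n f P A maximal = forest , λ S → mk⇔
  (λ (v , S⊆ , ⊆S) → v , connected⇒sameCycle ∘ S⊆ , ⊆S ∘ sameCycle⇒connected)
  (λ (v , S⊆ , ⊆S) → v , sameCycle⇒connected ∘ S⊆ , ⊆S ∘ connected⇒sameCycle)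
  where open Maximal k≤n f P A maximal
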